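{- Let $n\ge 1$ and $\nu>n$ be integers with $n\equiv \nu \pmod 2$. Then the minimum number of edges of an $n$-factor-critical graph on $\nu$ vertices is exactly $\nu(n+1)/2$.
   Context: All graphs are finite, connected and simple. A graph $G$ on $\nu$ vertices is $n$-factor-critical, where $0\le n\le \nu-2$, if $G-S$ has a perfect matching for every $S\subseteq V(G)$ with $|S|=n$. (Note that $\nu>n$ together with $\nu\equiv n \pmod 2$ gives $\nu\ge n+2$.) -}

module Defs where

open import Data.Fin using (Fin; _<?_)
open import Data.Fin.Subset using (Subset; _∈_; ∁; ∣_∣)
open import Data.List using (List; length; filter; allFin; cartesianProduct)
open import Data.Nat using (ℕ; _+_; _≤_)
open import Data.Product using (∃; _×_; _,_; proj₁; proj₂)
open import Function using (_on_)
open import Level using (Level; 0ℓ)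
open import Relation.Binary using (Rel; Decidable; Symmetric; Irreflexive; _⇒_)
open import Relation.Binary.Construct.Closure.ReflexiveTransitive using (Star)
open import Relation.Binary.PropositionalEquality using (_≡_; refl)
open import Relation.Nullary.Decidable using (_×-dec_)

-- Simple graphs; connectedness is a separate predicate because vertex-deleted
-- subgraphs and matchings are also `Graph`s but need not be connected.
record Graph (V : Set) : Set₁ where
  field
    Adj    : Rel V 0ℓ
    adj?   : Decidable Adj
    symm   : Symmetric Adj
    irrefl : Irreflexive _≡_ Adj

open Graph public

Connected : ∀ {V} → Graph V → Set
Connected G = ∀ u v → Star (Adj G) u v

-- Each edge is listed once, with its smaller endpoint first.
edges : ∀ {ν} → Graph (Fin ν) → List (Fin ν × Fin ν)
edges {ν} G =
  filter (λ (u , v) → (u <? v) ×-dec adj? G u v)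
         (cartesianProduct (allFin ν) (allFin ν))

numEdges : ∀ {ν} → Graph (Fin ν) → ℕ
numEdges G = length (edges G)

-- Membership in the complement, rather than non-membership in S, so that the
-- membership proof is unique and vertices are equal when their indices are.
Remaining : ∀ {ν} → Subset ν → Set
Remaining S = ∃ λ v → v ∈ ∁ S

infixl 6 _⊝_

_⊝_ : ∀ {ν} → Graph (Fin ν) → (S : Subset ν) → Graph (Remaining S)
G ⊝ S = record
  { Adj    = Adj G on proj₁
  ; adj?   = λ u v → adj? G (proj₁ u) (proj₁ v)
  ; symm   = symm G
  ; irrefl = λ { refl → irrefl G refl }
  }

-- The edge set of a matching is represented by the spanning subgraph M.
record PerfectMatching {V : Set} (G : Graph V) : Set₁ where
  field
    M        : Graph V
    subgraph : Adj M ⇒ Adj G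
    disjoint : ∀ {u v w} → Adj M u v → Adj M u w → v ≡ w
    covers   : ∀ u → ∃ λ v → Adj M u v

record FactorCritical (n : ℕ) {ν : ℕ} (G : Graph (Fin ν)) : Set₁ where
  field
    bound    : n + 2 ≤ ν
    critical : ∀ (S : Subset ν) → ∣ S ∣ ≡ n → PerfectMatching (G ⊝ S)

IsMinimum : ∀ {ℓ : Level} → (ℕ → Set ℓ) → ℕ → Set ℓ
IsMinimum P m = P m × (∀ k → P k → m ≤ k)

-- Lower bound: if some vertex u had degree at most n, deleting an n-set that contains all
-- neighbours of u but not u would isolate u; so all degrees are at least n + 1.
--
-- Upper bound: write n = 2k − 1 or n = 2k and take the k-th power of the cycle on ν vertices, plus
-- all antipodal chords if n = 2k. Call k cyclically consecutive deleted vertices a gap. If there is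
-- at most one gap, the remaining vertices lie on a path. Two disjoint gaps force n = 2k and leave
-- two arcs without deleted vertices; if these have odd order, the antipodal chord at the end of the
-- shorter one joins them, and what it leaves can be matched inside the arcs. The last step fails
-- only for n = 2 and ν/2 odd, where the prism over an odd cycle is used instead.
module Submission where

open import Defs
open import Data.Fin using (Fin)
open import Data.Nat using (ℕ; _+_; _*_; _≤_; _<_)
open import Data.Nat.DivMod using (_/_; _%_)
open import Data.Product using (Σ-syntax; _×_)
open import Relation.Binary.PropositionalEquality using (_≡_)

open import Data.Bool using (true; false)
open import Data.Empty using (⊥)
open import Data.Fin as Fin using (zero; suc; toℕ)
import Data.Fin.Properties as Fin
open import Data.Fin.Subset as Subset using (Subset; inside; outside; ∁; ∣_∣; ⁅_⁆; _⊆_)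
import Data.Fin.Subset.Properties as Subset
open import Data.List
  using (List; []; _∷_; [_]; _++_; length; map; filter; allFin; cartesianProduct; tabulate; iterate; applyUpTo)
open import Data.List.Membership.Propositional using (_∈_)
open import Data.List.Membership.Propositional.Properties
  using (∈-allFin; ∈-++⁻; ∈-++⁺ˡ; ∈-++⁺ʳ; ∈-filter⁺; ∈-filter⁻; ∈-map⁺; ∈-map⁻; ∈-∃++; ∈-applyUpTo⁺; ∈-applyUpTo⁻)
import Data.List.Membership.DecPropositional as DecMembership
open import Data.List.Properties
open import Data.List.Relation.Binary.Permutation.Propositional
  using (_↭_; ↭-refl; ↭-sym; ↭-trans; ↭-reflexive; prep; swap; ↭⇒↭ₛ)
import Data.List.Relation.Binary.Permutation.Propositional as Permutation
open import Data.List.Relation.Binary.Permutation.Propositional.Properties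
  using (∈-resp-↭; ↭-length; ↭-empty-inv; shift; shifts; ++⁺ˡ; ++⁺ʳ; ++-comm; drop-∷; filter-↭; ∷↭∷ʳ)
import Data.List.Relation.Binary.Permutation.Setoid.Properties as Permutationₛ
open import Data.List.Relation.Unary.All using ([]; _∷_)
open import Data.List.Relation.Unary.All.Properties using (All¬⇒¬Any)
open import Data.List.Relation.Unary.AllPairs using ([]; _∷_)
open import Data.List.Relation.Unary.Any using (here; there)
open import Data.List.Relation.Unary.Linked using (Linked; []; [-]; _∷_)
open import Data.List.Relation.Unary.Unique.Propositional using (Unique)
open import Data.List.Relation.Unary.Unique.Propositional.Properties using (allFin⁺; filter⁺)
open import Data.Nat using (zero; suc; _∸_; z≤n; s≤s; NonZero)
open import Data.Nat.DivMod
  using (_mod_; m%n<n; m%n%n≡m%n; [m+n]%n≡m%n; [m+kn]%n≡m%n; m<n⇒m%n≡m; %-distribˡ-+; m*n/n≡m; /-monoˡ-≤)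
open import Data.Nat.ListAction using (sum)
open import Data.Nat.Properties
open import Data.Nat.Tactic.RingSolver using (solve-∀)
open import Data.Product using (∃; ∃-syntax; _,_; proj₁; proj₂)
open import Data.Sum using (_⊎_; inj₁; inj₂)
open import Data.Vec as Vec using ([]; _∷_; here; there)
import Data.Vec.Properties as Vec
open import Data.Vec.Properties.WithK using ([]=-irrelevant)
open import Function using (_∘_; id)
open import Level using (0ℓ)
open import Relation.Binary using (Symmetric)
open import Relation.Binary.Construct.Closure.ReflexiveTransitive using (Star; ε; _◅_; _◅◅_; reverse)
open import Relation.Binary.Definitions using (Tri; tri<; tri≈; tri>)
open import Relation.Binary.PropositionalEquality hiding ([_])
open import Relation.Nullary using (¬_; Dec; yes; no; does; contradiction)
open import Relation.Nullary.Decidable using (_×-dec_; _⊎-dec_; dec-true)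
open import Relation.Unary using (Pred; Decidable)

-- Two disjoint gaps contain 2k deleted vertices: one too many if n = 2k - 1, and all of them if n =
-- 2k. So in the even case both arcs are intact, and their orders have the same parity because ν - n
-- is even. If these orders are 2i + 1 and 2(i + h) + 1, the antipode of the first vertex of the
-- shorter arc has offset h in the longer one and splits the rest of it into runs of h and 2i + h
-- vertices. For odd h the two vertices beside the antipode are matched to each other, which takes
-- the jump 2. That jump can be missing only if k = 1; then ν/2 = 2i + h + 2, so h is odd only when
-- ν/2 is odd. No edge count is ever computed exactly. The degrees of a circulant graph are at most
-- the length n + 1 of its list of jumps, and the lower bound, applied to the same graph, turns this
-- estimate into an equality.

m*2≡m+m : ∀ m → m * 2 ≡ m + m
m*2≡m+m = solve-∀

+-interchange : ∀ a b c d → (a + b) + (c + d) ≡ (a + c) + (b + d)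
+-interchange = solve-∀

-- Counting in lists and exchanging the order of summation.

module _ {A : Set} where

  count : {P : Pred A 0ℓ} → Decidable P → List A → ℕ
  count P? xs = length (filter P? xs)

  sum-map-≤ : ∀ (f : A → ℕ) c → (∀ x → f x ≤ c) → ∀ xs → sum (map f xs) ≤ length xs * c
  sum-map-≤ f c f≤c []       = z≤n
  sum-map-≤ f c f≤c (x ∷ xs) = +-mono-≤ (f≤c x) (sum-map-≤ f c f≤c xs)

  sum-map-≥ : ∀ (f : A → ℕ) c → (∀ x → c ≤ f x) → ∀ xs → length xs * c ≤ sum (map f xs)
  sum-map-≥ f c c≤f []       = z≤n
  sum-map-≥ f c c≤f (x ∷ xs) = +-mono-≤ (c≤f x) (sum-map-≥ f c c≤f xs)

  sum-map-+ : ∀ (f g : A → ℕ) xs → sum (map (λ x → f x + g x) xs) ≡ sum (map f xs) + sum (map g xs)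
  sum-map-+ f g []       = refl
  sum-map-+ f g (x ∷ xs) rewrite sum-map-+ f g xs = +-interchange (f x) (g x) _ _

  sum-map-cong : ∀ {f g : A → ℕ} → (∀ x → f x ≡ g x) → ∀ xs → sum (map f xs) ≡ sum (map g xs)
  sum-map-cong f≗g []       = refl
  sum-map-cong f≗g (x ∷ xs) = cong₂ _+_ (f≗g x) (sum-map-cong f≗g xs)

  count-map : ∀ {B : Set} {P : Pred A 0ℓ} (P? : Decidable P) (f : B → A) xs →
              count P? (map f xs) ≡ length (filter (P? ∘ f) xs)
  count-map P? f []       = refl
  count-map P? f (x ∷ xs) with does (P? (f x))
  ... | true  = cong suc (count-map P? f xs)
  ... | false = count-map P? f xs

  count-yes : ∀ {P : Pred A 0ℓ} (P? : Decidable P) {x} → P x → count P? (x ∷ []) ≡ 1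
  count-yes P? p = cong length (filter-accept P? p)

  count-no : ∀ {P : Pred A 0ℓ} (P? : Decidable P) {x} → ¬ P x → count P? (x ∷ []) ≡ 0
  count-no P? ¬p = cong length (filter-reject P? ¬p)

  count-++ : ∀ {P : Pred A 0ℓ} (P? : Decidable P) xs ys →
             count P? (xs ++ ys) ≡ count P? xs + count P? ys
  count-++ P? xs ys = trans (cong length (filter-++ P? xs ys)) (length-++ (filter P? xs))

  count-∷ : ∀ {P : Pred A 0ℓ} (P? : Decidable P) x xs →
            count P? (x ∷ xs) ≡ count P? (x ∷ []) + count P? xs
  count-∷ P? x xs = count-++ P? (x ∷ []) xs

  -- Stating the hypothesis on singletons confines the case distinctions to one element and keeps
  -- them out of the induction.
  count-split : ∀ {P Q R : Pred A 0ℓ} (P? : Decidable P) (Q? : Decidable Q) (R? : Decidable R) →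
                (∀ x → count P? (x ∷ []) ≡ count Q? (x ∷ []) + count R? (x ∷ [])) →
                ∀ xs → count P? xs ≡ count Q? xs + count R? xs
  count-split P? Q? R? eq []       = refl
  count-split P? Q? R? eq (x ∷ xs)
    rewrite count-∷ P? x xs | count-∷ Q? x xs | count-∷ R? x xs | eq x | count-split P? Q? R? eq xs
    = +-interchange (count Q? (x ∷ [])) (count R? (x ∷ [])) _ _

module _ {A B : Set} {P : A × B → Set} (P? : Decidable P) where

  count-cartesianProduct : ∀ xs ys →
    count P? (cartesianProduct xs ys) ≡ sum (map (λ x → count (λ y → P? (x , y)) ys) xs)
  count-cartesianProduct []       ys = refl
  count-cartesianProduct (x ∷ xs) ys =
    trans (count-++ P? (map (x ,_) ys) (cartesianProduct xs ys))
          (cong₂ _+_ (count-map P? (x ,_) ys) (count-cartesianProduct xs ys))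

  sum-count-comm : ∀ xs ys →
    sum (map (λ x → count (λ y → P? (x , y)) ys) xs) ≡ sum (map (λ y → count (λ x → P? (x , y)) xs) ys)
  sum-count-comm [] ys = sym (sum-zero ys)
    where
    sum-zero : ∀ (zs : List B) → sum (map (λ _ → 0) zs) ≡ 0
    sum-zero []       = refl
    sum-zero (_ ∷ zs) = sum-zero zs
  sum-count-comm (x ∷ xs) ys = begin
    count (λ y → P? (x , y)) ys + sum (map (λ x → count (λ y → P? (x , y)) ys) xs)
      ≡⟨ cong₂ _+_ (count-as-sum ys) (sum-count-comm xs ys) ⟩
    sum (map (λ y → count (λ x → P? (x , y)) (x ∷ [])) ys) + sum (map (λ y → count (λ x → P? (x , y)) xs) ys)
      ≡⟨ sum-map-+ _ _ ys ⟨
    sum (map (λ y → count (λ x → P? (x , y)) (x ∷ []) + count (λ x → P? (x , y)) xs) ys)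
      ≡⟨ sum-map-cong (λ y → count-∷ (λ x → P? (x , y)) x xs) ys ⟨
    sum (map (λ y → count (λ x → P? (x , y)) (x ∷ xs)) ys) ∎
    where
    open ≡-Reasoning
    count-as-sum : ∀ zs → count (λ y → P? (x , y)) zs ≡ sum (map (λ y → count (λ x → P? (x , y)) (x ∷ [])) zs)
    count-as-sum []       = refl
    count-as-sum (z ∷ zs) with does (P? (x , z))
    ... | true  = cong suc (count-as-sum zs)
    ... | false = count-as-sum zs

count≡∣tabulate∣ : ∀ {A : Set} {P : Pred A 0ℓ} (P? : Decidable P) {n} (f : Fin n → A) →
                   count P? (tabulate f) ≡ ∣ Vec.tabulate (does ∘ P? ∘ f) ∣
count≡∣tabulate∣ P? {zero}  f = refl
count≡∣tabulate∣ P? {suc n} f with does (P? (f zero))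
... | true  = cong suc (count≡∣tabulate∣ P? (f ∘ suc))
... | false = count≡∣tabulate∣ P? (f ∘ suc)

-- Degrees and double counting of edges.

module _ {ν : ℕ} (G : Graph (Fin ν)) where

  degree : Fin ν → ℕ
  degree u = count (adj? G u) (allFin ν)

  -- Each degree splits into larger and smaller neighbours. Summed over all vertices, both parts
  -- count `edges G`: the first directly, the second after the order of summation is exchanged.
  handshake : sum (map degree (allFin ν)) ≡ numEdges G + numEdges G
  handshake = begin
    sum (map degree V)                                                 ≡⟨ sum-map-cong degree-split V ⟩
    sum (map (λ u → count (up? ∘ (u ,_)) V + count (up? ∘ (_, u)) V) V) ≡⟨ sum-map-+ _ _ V ⟩
    sum (map (λ u → count (up? ∘ (u ,_)) V) V) + sum (map (λ u → count (up? ∘ (_, u)) V) V)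
      ≡⟨ cong (sum (map (λ u → count (up? ∘ (u ,_)) V) V) +_) (sum-count-comm up? V V) ⟨
    sum (map (λ u → count (up? ∘ (u ,_)) V) V) + sum (map (λ u → count (up? ∘ (u ,_)) V) V)
      ≡⟨ cong (λ e → e + e) (count-cartesianProduct up? V V) ⟨
    numEdges G + numEdges G ∎
    where
    open ≡-Reasoning
    V = allFin ν

    Up : Fin ν × Fin ν → Set
    Up (u , v) = u Fin.< v × Adj G u v

    up? : Decidable Up
    up? (u , v) = (u Fin.<? v) ×-dec adj? G u v

    Singleton : Fin ν → Fin ν → Set
    Singleton u v = count (adj? G u) (v ∷ []) ≡ count (up? ∘ (u ,_)) (v ∷ []) + count (up? ∘ (_, u)) (v ∷ [])

    count-pair : ∀ u v → Dec (Adj G u v) → Tri (u Fin.< v) (u ≡ v) (v Fin.< u) → Singleton u v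
    count-pair u v (no ¬a) _ = trans (count-no (adj? G u) ¬a) (sym (cong₂ _+_
      (count-no (up? ∘ (u ,_)) (¬a ∘ proj₂)) (count-no (up? ∘ (_, u)) (¬a ∘ symm G ∘ proj₂))))
    count-pair u v (yes a) (tri< p _ ¬q) = trans (count-yes (adj? G u) a) (sym (cong₂ _+_
      (count-yes (up? ∘ (u ,_)) (p , a)) (count-no (up? ∘ (_, u)) (¬q ∘ proj₁))))
    count-pair u v (yes a) (tri≈ _ u≡v _) = contradiction a (irrefl G u≡v)
    count-pair u v (yes a) (tri> ¬p _ q) = trans (count-yes (adj? G u) a) (sym (cong₂ _+_
      (count-no (up? ∘ (u ,_)) (¬p ∘ proj₁)) (count-yes (up? ∘ (_, u)) (q , symm G a))))

    degree-split : ∀ u → degree u ≡ count (up? ∘ (u ,_)) V + count (up? ∘ (_, u)) V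
    degree-split u = count-split (adj? G u) (up? ∘ (u ,_)) (up? ∘ (_, u)) (λ v → count-pair u v (adj? G u v) (Fin.<-cmp u v)) V

-- The lower bound: deleting a neighbourhood.

interpolate : ∀ {ν} (P Q : Subset ν) n → P ⊆ Q → ∣ P ∣ ≤ n → n ≤ ∣ Q ∣ →
              ∃[ S ] P ⊆ S × S ⊆ Q × ∣ S ∣ ≡ n
interpolate [] [] zero P⊆Q _ _ = [] , id , id , refl
interpolate (inside ∷ P) (outside ∷ Q) n P⊆Q _ _ with () ← P⊆Q here
interpolate (inside ∷ P) (inside ∷ Q) (suc n) P⊆Q (s≤s P≤n) (s≤s n≤Q)
  with S , P⊆S , S⊆Q , eq ← interpolate P Q n (Subset.drop-∷-⊆ P⊆Q) P≤n n≤Q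
  = inside ∷ S , (λ { here → here ; (there x) → there (P⊆S x) })
               , (λ { here → here ; (there x) → there (S⊆Q x) }) , cong suc eq
interpolate (outside ∷ P) (outside ∷ Q) n P⊆Q P≤n n≤Q
  with S , P⊆S , S⊆Q , eq ← interpolate P Q n (Subset.drop-∷-⊆ P⊆Q) P≤n n≤Q
  = outside ∷ S , (λ { (there x) → there (P⊆S x) }) , (λ { (there x) → there (S⊆Q x) }) , eq
interpolate (outside ∷ P) (inside ∷ Q) n P⊆Q P≤n n≤Q with n ≤? ∣ Q ∣
... | yes n≤Q′
  with S , P⊆S , S⊆Q , eq ← interpolate P Q n (Subset.drop-∷-⊆ P⊆Q) P≤n n≤Q′
  = outside ∷ S , (λ { (there x) → there (P⊆S x) }) , (λ { (there x) → there (S⊆Q x) }) , eq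
-- Now `n` exceeds the size of the tail `Q`, hence equals that of `inside ∷ Q`, and the whole upper
-- set is the only choice.
... | no n≰Q
  = inside ∷ Q , (λ { (there x) → there (Subset.drop-∷-⊆ P⊆Q x) }) , id , ≤-antisym (≰⇒> n≰Q) n≤Q

module _ {n ν : ℕ} {G : Graph (Fin ν)} (fc : FactorCritical n G) where

  open FactorCritical fc

  factorCritical⇒degree> : ∀ u → n < degree G u
  factorCritical⇒degree> u with n <? degree G u
  ... | yes n<deg = n<deg
  ... | no  n≮deg = contradiction (proj₂ partner) not-adjacent
    where
    N : Subset ν
    N = Vec.tabulate (does ∘ adj? G u)

    ∈N⁺ : ∀ {v} → Adj G u v → v Subset.∈ N
    ∈N⁺ {v} a = Vec.lookup⇒[]= v N (trans (Vec.lookup∘tabulate _ v) (dec-true (adj? G u v) a))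

    ∈N⁻ : ∀ {v} → v Subset.∈ N → Adj G u v
    ∈N⁻ {v} v∈N with adj? G u v | trans (sym (Vec.lookup∘tabulate (does ∘ adj? G u) v)) (Vec.[]=⇒lookup v∈N)
    ... | yes a | _ = a
    ... | no _  | ()

    N⊆∁u : N ⊆ ∁ ⁅ u ⁆
    N⊆∁u v∈N = Subset.x∉p⇒x∈∁p λ v∈u → irrefl G (sym (Subset.x∈⁅y⁆⇒x≡y u v∈u)) (∈N⁻ v∈N)

    n≤∣∁u∣ : n ≤ ∣ ∁ ⁅ u ⁆ ∣
    n≤∣∁u∣ rewrite Subset.∣∁p∣≡n∸∣p∣ ⁅ u ⁆ | Subset.∣⁅x⁆∣≡1 u =
      ≤-trans (subst (n ≤_) (sym (+-∸-assoc n (s≤s z≤n))) (m≤m+n n 1)) (∸-monoˡ-≤ 1 bound)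

    separator = interpolate N (∁ ⁅ u ⁆) n N⊆∁u
                  (subst (_≤ n) (count≡∣tabulate∣ (adj? G u) id) (≮⇒≥ n≮deg)) n≤∣∁u∣
    S   = proj₁ separator
    N⊆S = proj₁ (proj₂ separator)
    S⊆∁u = proj₁ (proj₂ (proj₂ separator))

    open PerfectMatching (critical S (proj₂ (proj₂ (proj₂ separator))))

    partner = covers (u , Subset.x∉p⇒x∈∁p λ u∈S → Subset.x∈∁p⇒x∉p (S⊆∁u u∈S) (Subset.x∈⁅x⁆ u))

    not-adjacent : ¬ Adj M _ (proj₁ partner)
    not-adjacent a = Subset.x∈∁p⇒x∉p (proj₂ (proj₁ partner)) (N⊆S (∈N⁺ (subgraph a)))

  numEdges-lower : ν * (n + 1) ≤ numEdges G * 2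
  numEdges-lower = begin
    ν * (n + 1)                     ≡⟨ cong₂ _*_ (sym (length-tabulate {n = ν} id)) (+-comm n 1) ⟩
    length (allFin ν) * suc n       ≤⟨ sum-map-≥ (degree G) (suc n) factorCritical⇒degree> (allFin ν) ⟩
    sum (map (degree G) (allFin ν)) ≡⟨ handshake G ⟩
    numEdges G + numEdges G         ≡⟨ m*2≡m+m (numEdges G) ⟨
    numEdges G * 2                  ∎
    where open ≤-Reasoning

-- Matchings as pairings of a list up to permutation.

module _ {A : Set} where

  Unique-resp-↭ : ∀ {xs ys : List A} → xs ↭ ys → Unique xs → Unique ys
  Unique-resp-↭ p = Permutationₛ.Unique-resp-↭ (setoid A) (↭⇒↭ₛ p)

  Unique-⊆⇒length≤ : ∀ {xs ys : List A} → Unique xs → (∀ {x} → x ∈ xs → x ∈ ys) → length xs ≤ length ys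
  Unique-⊆⇒length≤ {[]} _ _ = z≤n
  Unique-⊆⇒length≤ {x ∷ xs} {ys} (x∉xs ∷ u) xs⊆ys with as , bs , refl ← ∈-∃++ (xs⊆ys (here refl)) =
    subst (suc (length xs) ≤_) (sym (↭-length (shift x as bs)))
      (s≤s (Unique-⊆⇒length≤ u λ z∈xs → drop-head z∈xs (∈-resp-↭ (shift x as bs) (xs⊆ys (there z∈xs)))))
    where
    drop-head : ∀ {z} → z ∈ xs → z ∈ x ∷ as ++ bs → z ∈ as ++ bs
    drop-head z∈xs (here refl) = contradiction z∈xs (All¬⇒¬Any x∉xs)
    drop-head z∈xs (there z∈)  = z∈

  interchange : ∀ (as bs cs ds : List A) → (as ++ bs) ++ (cs ++ ds) ↭ (as ++ cs) ++ (bs ++ ds)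
  interchange as bs cs ds = begin
    (as ++ bs) ++ (cs ++ ds) ≡⟨ ++-assoc as bs (cs ++ ds) ⟩
    as ++ bs ++ cs ++ ds     ↭⟨ ++⁺ˡ as (shifts bs cs) ⟩
    as ++ cs ++ bs ++ ds     ≡⟨ ++-assoc as cs (bs ++ ds) ⟨
    (as ++ cs) ++ (bs ++ ds) ∎
    where open Permutation.PermutationReasoning

  -- The permutation in `pair` makes the order of the list irrelevant: matchings of pieces are glued
  -- with `_++ᵖ_` and then carried over to the vertex list by `resp-↭`.
  data PairsUp (R : A → A → Set) : List A → Set where
    []   : PairsUp R []
    pair : ∀ {x y xs ys} → R x y → PairsUp R xs → ys ↭ x ∷ y ∷ xs → PairsUp R ys

  module _ {R : A → A → Set} where

    resp-↭ : ∀ {xs ys} → xs ↭ ys → PairsUp R xs → PairsUp R ys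
    resp-↭ σ []           with refl ← ↭-empty-inv (↭-sym σ) = []
    resp-↭ σ (pair r p τ) = pair r p (↭-trans (↭-sym σ) τ)

    infixr 5 _++ᵖ_
    _++ᵖ_ : ∀ {xs ys} → PairsUp R xs → PairsUp R ys → PairsUp R (xs ++ ys)
    []         ++ᵖ q = q
    pair r p σ ++ᵖ q = pair r (p ++ᵖ q) (++⁺ʳ _ σ)

    -- Every second link of the path is used, the links between being dropped.
    Linked⇒PairsUp : ∀ {xs} t → length xs ≡ t * 2 → Linked R xs → PairsUp R xs
    Linked⇒PairsUp zero    _  []            = []
    Linked⇒PairsUp (suc t) eq (r ∷ [-])     = pair r [] ↭-refl
    Linked⇒PairsUp (suc t) eq (r ∷ _ ∷ rs)  =
      pair r (Linked⇒PairsUp t (suc-injective (suc-injective eq)) rs) ↭-refl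

    Partner : ∀ {xs} → PairsUp R xs → A → A → Set
    Partner []                     u v = ⊥
    Partner (pair {x} {y} _ p _)   u v = (u ≡ x × v ≡ y) ⊎ (u ≡ y × v ≡ x) ⊎ Partner p u v

    partner-sym : ∀ {xs} (p : PairsUp R xs) {u v} → Partner p u v → Partner p v u
    partner-sym (pair _ p _) (inj₁ (a , b))        = inj₂ (inj₁ (b , a))
    partner-sym (pair _ p _) (inj₂ (inj₁ (a , b))) = inj₁ (b , a)
    partner-sym (pair _ p _) (inj₂ (inj₂ m))       = inj₂ (inj₂ (partner-sym p m))

    partner⇒R : Symmetric R → ∀ {xs} (p : PairsUp R xs) {u v} → Partner p u v → R u v
    partner⇒R s (pair r p _) (inj₁ (refl , refl))        = r
    partner⇒R s (pair r p _) (inj₂ (inj₁ (refl , refl))) = s r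
    partner⇒R s (pair r p _) (inj₂ (inj₂ m))             = partner⇒R s p m

    partner-∈ : ∀ {xs} (p : PairsUp R xs) {u v} → Partner p u v → u ∈ xs
    partner-∈ (pair _ p σ) (inj₁ (refl , _))        = ∈-resp-↭ (↭-sym σ) (here refl)
    partner-∈ (pair _ p σ) (inj₂ (inj₁ (refl , _))) = ∈-resp-↭ (↭-sym σ) (there (here refl))
    partner-∈ (pair _ p σ) (inj₂ (inj₂ m))          = ∈-resp-↭ (↭-sym σ) (there (there (partner-∈ p m)))

    partner-covers : ∀ {xs} (p : PairsUp R xs) {u} → u ∈ xs → ∃[ v ] Partner p u v
    partner-covers (pair _ p σ) u∈xs with ∈-resp-↭ σ u∈xs
    ... | here refl          = _ , inj₁ (refl , refl)
    ... | there (here refl)  = _ , inj₂ (inj₁ (refl , refl))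
    ... | there (there u∈xs) with v , m ← partner-covers p u∈xs = v , inj₂ (inj₂ m)

    -- A vertex with two different partners would occur at two places of the list.
    partner-unique : ∀ {xs} (p : PairsUp R xs) → Unique xs → ∀ {u v w} → Partner p u v → Partner p u w → v ≡ w
    partner-unique (pair {x} {y} {zs} r p σ) uniq = go (Unique-resp-↭ σ uniq)
      where
      go : Unique (x ∷ y ∷ zs) → ∀ {u v w} → Partner (pair r p σ) u v → Partner (pair r p σ) u w → v ≡ w
      go _                 (inj₁ (_ , refl))           (inj₁ (_ , refl))           = refl
      go _                 (inj₂ (inj₁ (_ , refl)))    (inj₂ (inj₁ (_ , refl)))    = refl
      go (_ ∷ _ ∷ us)      (inj₂ (inj₂ m))             (inj₂ (inj₂ m′))            = partner-unique p us m m′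
      go ((x≢y ∷ _) ∷ _)   (inj₁ (refl , _))           (inj₂ (inj₁ (refl , _)))    = contradiction refl x≢y
      go ((x≢y ∷ _) ∷ _)   (inj₂ (inj₁ (refl , _)))    (inj₁ (refl , _))           = contradiction refl x≢y
      go ((_ ∷ x∉) ∷ _)    (inj₁ (refl , _))           (inj₂ (inj₂ m))             = contradiction (partner-∈ p m) (All¬⇒¬Any x∉)
      go ((_ ∷ x∉) ∷ _)    (inj₂ (inj₂ m))             (inj₁ (refl , _))           = contradiction (partner-∈ p m) (All¬⇒¬Any x∉)
      go (_ ∷ y∉ ∷ _)      (inj₂ (inj₁ (refl , _)))    (inj₂ (inj₂ m))             = contradiction (partner-∈ p m) (All¬⇒¬Any y∉)
      go (_ ∷ y∉ ∷ _)      (inj₂ (inj₂ m))             (inj₂ (inj₁ (refl , _)))    = contradiction (partner-∈ p m) (All¬⇒¬Any y∉)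

    partner? : (∀ (x y : A) → Dec (x ≡ y)) → ∀ {xs} (p : PairsUp R xs) u v → Dec (Partner p u v)
    partner? _≟_ []                   u v = no λ ()
    partner? _≟_ (pair {x} {y} _ p _) u v =
      ((u ≟ x) ×-dec (v ≟ y)) ⊎-dec ((u ≟ y) ×-dec (v ≟ x)) ⊎-dec partner? _≟_ p u v

length-elements : ∀ {ν} (p : Subset ν) → length (filter (Subset._∈? p) (allFin ν)) ≡ ∣ p ∣
length-elements p = trans (count≡∣tabulate∣ (Subset._∈? p) id)
  (cong ∣_∣ (trans (Vec.tabulate-cong does-∈?) (Vec.tabulate∘lookup p)))
  where
  does-∈? : ∀ i → does (i Subset.∈? p) ≡ Vec.lookup p i
  does-∈? i with i Subset.∈? p | Vec.lookup p i in eq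
  ... | yes i∈ | _     = trans (sym (Vec.[]=⇒lookup i∈)) eq
  ... | no _   | false = refl
  ... | no i∉  | true  = contradiction (Vec.lookup⇒[]= i p eq) i∉

two-elements : ∀ {ν} (S : Subset ν) → ∣ S ∣ ≡ 2 → ∃[ u ] ∃[ w ] u ≢ w × u Subset.∈ S × w Subset.∈ S
two-elements {ν} S ∣S∣≡2
  with filter (Subset._∈? S) (allFin ν) | trans (length-elements S) ∣S∣≡2
     | filter⁺ (Subset._∈? S) (allFin⁺ ν) | (λ {v} → ∈-filter⁻ (Subset._∈? S) {v = v} {xs = allFin ν})
... | u ∷ w ∷ [] | refl | (u≢w ∷ []) ∷ _ | ∈⁻ =
  u , w , u≢w , proj₂ (∈⁻ (here refl)) , proj₂ (∈⁻ (there (here refl)))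

module _ {ν : ℕ} (G : Graph (Fin ν)) (S : Subset ν) where

  remaining : List (Fin ν)
  remaining = filter (Subset._∈? ∁ S) (allFin ν)

  pairsUp⇒perfectMatching : PairsUp (Adj G) remaining → PerfectMatching (G ⊝ S)
  pairsUp⇒perfectMatching p = record
    { M = record
      { Adj    = λ u v → Partner p (proj₁ u) (proj₁ v)
      ; adj?   = λ u v → partner? Fin._≟_ p (proj₁ u) (proj₁ v)
      ; symm   = partner-sym p
      ; irrefl = λ { {u} refl m → irrefl G refl (partner⇒R (symm G) p m) }
      }
    ; subgraph = partner⇒R (symm G) p
    ; disjoint = λ m m′ → ≡-remaining (partner-unique p (filter⁺ (Subset._∈? ∁ S) (allFin⁺ ν)) m m′)
    ; covers   = covers
    }
    where
    ≡-remaining : {u v : Remaining S} → proj₁ u ≡ proj₁ v → u ≡ v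
    ≡-remaining {_ , p} {_ , q} refl = cong (_ ,_) ([]=-irrelevant p q)

    covers : ∀ (u : Remaining S) → ∃ λ (v : Remaining S) → Partner p (proj₁ u) (proj₁ v)
    covers (u , u∈) with v , m ← partner-covers p (∈-filter⁺ (Subset._∈? ∁ S) (∈-allFin u) u∈) =
      (v , proj₂ (∈-filter⁻ (Subset._∈? ∁ S) {xs = allFin ν} (partner-∈ p (partner-sym p m)))) , m

-- Positions on a cycle of ν vertices.

module Cyclic (ν : ℕ) .{{_ : NonZero ν}} where

  vert : ℕ → Fin ν
  vert x = x mod ν

  toℕ-vert : ∀ x → toℕ (vert x) ≡ x % ν
  toℕ-vert x = Fin.toℕ-fromℕ< (m%n<n x ν)

  vert-cong : ∀ {x y} → x % ν ≡ y % ν → vert x ≡ vert y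
  vert-cong {x} {y} eq = Fin.toℕ-injective (trans (toℕ-vert x) (trans eq (sym (toℕ-vert y))))

  vert-toℕ : ∀ u → vert (toℕ u) ≡ u
  vert-toℕ u = Fin.toℕ-injective (trans (toℕ-vert (toℕ u)) (m<n⇒m%n≡m (Fin.toℕ<n u)))

  vert-+ν : ∀ x → vert (x + ν) ≡ vert x
  vert-+ν x = vert-cong ([m+n]%n≡m%n x ν)

  vert-toℕ-+ : ∀ x d → vert (toℕ (vert x) + d) ≡ vert (x + d)
  vert-toℕ-+ x d = vert-cong (begin
    (toℕ (vert x) + d) % ν      ≡⟨ cong (λ r → (r + d) % ν) (toℕ-vert x) ⟩
    (x % ν + d) % ν             ≡⟨ %-distribˡ-+ (x % ν) d ν ⟩
    (x % ν % ν + d % ν) % ν     ≡⟨ cong (λ r → (r + d % ν) % ν) (m%n%n≡m%n x ν) ⟩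
    (x % ν + d % ν) % ν         ≡⟨ %-distribˡ-+ x d ν ⟨
    (x + d) % ν                 ∎)
    where open ≡-Reasoning

  vert-fixed : ∀ u {d} → d < ν → vert (toℕ u + d) ≡ u → d ≡ 0
  vert-fixed u {d} d<ν eq with toℕ u + d <? ν
  ... | yes u+d<ν = +-cancelˡ-≡ (toℕ u) d 0 (begin
    toℕ u + d            ≡⟨ m<n⇒m%n≡m u+d<ν ⟨
    (toℕ u + d) % ν      ≡⟨ toℕ-vert (toℕ u + d) ⟨
    toℕ (vert (toℕ u + d)) ≡⟨ cong toℕ eq ⟩
    toℕ u                ≡⟨ +-identityʳ (toℕ u) ⟨
    toℕ u + 0            ∎)
    where open ≡-Reasoning
  -- After one turn `u` would equal `u + d ∸ ν`, which forces `d` to be `ν`.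
  ... | no u+d≮ν = contradiction (begin
    toℕ u + ν                ≡⟨ cong (_+ ν) u≡r ⟩
    (toℕ u + d ∸ ν) + ν      ≡⟨ m∸n+n≡m (≮⇒≥ u+d≮ν) ⟩
    toℕ u + d                ∎) λ e → <⇒≢ d<ν (sym (+-cancelˡ-≡ (toℕ u) ν d e))
    where
    open ≡-Reasoning
    r<ν : toℕ u + d ∸ ν < ν
    r<ν = +-cancelʳ-< ν _ ν (subst (_< ν + ν) (sym (m∸n+n≡m (≮⇒≥ u+d≮ν))) (+-mono-<-≤ (Fin.toℕ<n u) (<⇒≤ d<ν)))
    u≡r : toℕ u ≡ toℕ u + d ∸ ν
    u≡r = begin
      toℕ u                    ≡⟨ cong toℕ eq ⟨
      toℕ (vert (toℕ u + d))   ≡⟨ toℕ-vert (toℕ u + d) ⟩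
      (toℕ u + d) % ν          ≡⟨ cong (_% ν) (m∸n+n≡m (≮⇒≥ u+d≮ν)) ⟨
      (toℕ u + d ∸ ν + ν) % ν  ≡⟨ [m+n]%n≡m%n (toℕ u + d ∸ ν) ν ⟩
      (toℕ u + d ∸ ν) % ν      ≡⟨ m<n⇒m%n≡m r<ν ⟩
      toℕ u + d ∸ ν            ∎

  -- The start is an unreduced natural number, so that arcs crossing the vertex 0 need no case of
  -- their own. The step `d` is 1 for arcs of the cycle and 2 for the rows of the prism.
  progression : ℕ → ℕ → ℕ → List (Fin ν)
  progression d s l = map vert (iterate (d +_) s l)

  length-progression : ∀ d s l → length (progression d s l) ≡ l
  length-progression d s l = trans (length-map vert (iterate (d +_) s l)) (length-iterate (d +_) s l)

  progression-++ : ∀ d s a b → progression d s (a + b) ≡ progression d s a ++ progression d (s + a * d) b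
  progression-++ d s zero    b = cong (λ s → progression d s b) (sym (+-identityʳ s))
  progression-++ d s (suc a) b = cong (vert s ∷_) (trans (progression-++ d (d + s) a b)
    (cong (λ s′ → progression d (d + s) a ++ progression d s′ b) (shift-start d s (a * d))))
    where
    shift-start : ∀ d s x → d + s + x ≡ s + (d + x)
    shift-start = solve-∀

  progression-+ν : ∀ d s l → progression d (s + ν) l ≡ progression d s l
  progression-+ν d s zero    = refl
  progression-+ν d s (suc l) = cong₂ _∷_ (vert-+ν s)
    (trans (cong (λ s → progression d s l) (sym (+-assoc d s ν))) (progression-+ν d (d + s) l))

  ∈-progression⁻ : ∀ d s l {w} → w ∈ progression d s l → ∃[ e ] ∃[ f ] l ≡ e + suc f × w ≡ vert (s + e * d)
  ∈-progression⁻ d s (suc l) (here refl) = 0 , l , refl , cong vert (sym (+-identityʳ s))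
  ∈-progression⁻ d s (suc l) (there w∈) with e , f , refl , refl ← ∈-progression⁻ d (d + s) l w∈ =
    suc e , f , refl , cong vert (shift-start d s (e * d))
    where
    shift-start : ∀ d s x → d + s + x ≡ s + (d + x)
    shift-start = solve-∀

  window : ℕ → ℕ → List (Fin ν)
  window = progression 1

  window-++ : ∀ s a b → window s (a + b) ≡ window s a ++ window (s + a) b
  window-++ s a b = trans (progression-++ 1 s a b) (cong (λ x → window s a ++ window (s + x) b) (*-identityʳ a))

  -- Induction on `s`: the window of length `1 + ν` at `s` begins and ends with the same vertex, and
  -- dropping either copy leaves a full turn, from `suc s` or from `s`.
  window-all : ∀ s → window s ν ↭ allFin ν
  window-all zero    = ↭-reflexive (go ν 0 id λ i → trans (vert-toℕ i) refl)
    where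
    go : ∀ l s (f : Fin l → Fin ν) → (∀ i → vert (s + toℕ i) ≡ f i) → window s l ≡ tabulate f
    go zero    s f eq = refl
    go (suc l) s f eq = cong₂ _∷_ (trans (cong vert (sym (+-identityʳ s))) (eq zero))
      (go l (suc s) (f ∘ suc) λ i → trans (cong vert (sym (+-suc s (toℕ i)))) (eq (suc i)))
  window-all (suc s) = begin
    window (suc s) ν            ↭⟨ drop-∷ step ⟩
    window s ν                  ↭⟨ window-all s ⟩
    allFin ν                    ∎
    where
    open Permutation.PermutationReasoning
    step : vert s ∷ window (suc s) ν ↭ vert s ∷ window s ν
    step = begin
      window s (1 + ν)               ≡⟨ cong (window s) (+-comm 1 ν) ⟩
      window s (ν + 1)               ≡⟨ window-++ s ν 1 ⟩
      window s ν ++ [ vert (s + ν) ] ≡⟨ cong (λ v → window s ν ++ [ v ]) (vert-+ν s) ⟩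
      window s ν ++ [ vert s ]       ↭⟨ ∷↭∷ʳ (vert s) (window s ν) ⟨
      vert s ∷ window s ν            ∎

-- Circulant graphs given by a list of jumps.

record Jumps (ν : ℕ) (J : List ℕ) : Set where
  field
    positive : ∀ {d} → d ∈ J → 0 < d
    bounded  : ∀ {d} → d ∈ J → d < ν
    mirror   : ∀ {d} → d ∈ J → ν ∸ d ∈ J

module Circulant {ν : ℕ} .{{_ : NonZero ν}} {J : List ℕ} (jumps : Jumps ν J) where

  open Cyclic ν
  open Jumps jumps
  open DecMembership (Fin._≟_ {ν}) using (_∈?_)

  translates : Fin ν → List (Fin ν)
  translates u = map (λ d → vert (toℕ u + d)) J

  circulant : Graph (Fin ν)
  circulant = record
    { Adj    = λ u v → v ∈ translates u
    ; adj?   = λ u v → v ∈? translates u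
    ; symm   = symmetric
    ; irrefl = irreflexive
    }
    where
    symmetric : Symmetric λ u v → v ∈ translates u
    symmetric {u} v∈ with d , d∈J , refl ← ∈-map⁻ _ v∈ =
      subst (_∈ translates (vert (toℕ u + d))) back (∈-map⁺ _ (mirror d∈J))
      where
      open ≡-Reasoning
      back : vert (toℕ (vert (toℕ u + d)) + (ν ∸ d)) ≡ u
      back = begin
        vert (toℕ (vert (toℕ u + d)) + (ν ∸ d)) ≡⟨ vert-toℕ-+ (toℕ u + d) (ν ∸ d) ⟩
        vert (toℕ u + d + (ν ∸ d))              ≡⟨ cong vert (+-assoc (toℕ u) d (ν ∸ d)) ⟩
        vert (toℕ u + (d + (ν ∸ d)))            ≡⟨ cong (λ x → vert (toℕ u + x)) (m+[n∸m]≡n (<⇒≤ (bounded d∈J))) ⟩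
        vert (toℕ u + ν)                        ≡⟨ vert-+ν (toℕ u) ⟩
        vert (toℕ u)                            ≡⟨ vert-toℕ u ⟩
        u                                       ∎

    irreflexive : ∀ {u v} → u ≡ v → ¬ (v ∈ translates u)
    irreflexive {u} refl v∈ with d , d∈J , eq ← ∈-map⁻ _ v∈ =
      <⇒≢ (positive d∈J) (sym (vert-fixed u (bounded d∈J) (sym eq)))

  edge : ∀ {d} → d ∈ J → ∀ x → Adj circulant (vert x) (vert (x + d))
  edge {d} d∈J x = subst (_∈ translates (vert x)) (vert-toℕ-+ x d) (∈-map⁺ _ d∈J)

  -- All neighbours occur among the translates, and coinciding translates could only lower the
  -- degree. The reverse inequality comes from factor-criticality.
  degree≤ : ∀ u → degree circulant u ≤ length J
  degree≤ u = subst (degree circulant u ≤_) (length-map _ J)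
    (Unique-⊆⇒length≤ (filter⁺ (adj? circulant u) (allFin⁺ ν)) λ v∈ →
      proj₂ (∈-filter⁻ (adj? circulant u) {xs = allFin ν} v∈))

  connected : (∀ x → Star (Adj circulant) (vert x) (vert (suc x))) → Connected circulant
  connected step u v = reverse (symm circulant) (from-zero u) ◅◅ from-zero v
    where
    climb : ∀ x → Star (Adj circulant) (vert 0) (vert x)
    climb zero    = ε
    climb (suc x) = climb x ◅◅ step x

    from-zero : ∀ u → Star (Adj circulant) (vert 0) u
    from-zero u = subst (Star (Adj circulant) (vert 0)) (vert-toℕ u) (climb (toℕ u))

  progression-pairsUp : ∀ {d} → d ∈ J → ∀ s t → PairsUp (Adj circulant) (progression d s (t * 2))
  progression-pairsUp     d∈J s zero    = []
  progression-pairsUp {d} d∈J s (suc t) =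
    pair (subst (Adj circulant (vert s) ∘ vert) (+-comm s d) (edge d∈J s)) (progression-pairsUp d∈J _ t) ↭-refl

  -- The two progressions are the sides of a ladder, and the jump `m` joins vertices with equal
  -- index.
  rungs-pairsUp : ∀ {m} → m ∈ J → ∀ d s l → PairsUp (Adj circulant) (progression d s l ++ progression d (s + m) l)
  rungs-pairsUp     m∈J d s zero    = []
  rungs-pairsUp {m} m∈J d s (suc l) =
    pair (edge m∈J s) (subst (λ s′ → PairsUp (Adj circulant) (progression d (d + s) l ++ progression d s′ l))
                             (+-assoc d s m) (rungs-pairsUp m∈J d (d + s) l))
         (prep _ (shift _ (progression d (d + s) l) _))

  numEdges-upper : numEdges circulant * 2 ≤ ν * length J
  numEdges-upper = begin
    numEdges circulant * 2                  ≡⟨ m*2≡m+m (numEdges circulant) ⟩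
    numEdges circulant + numEdges circulant ≡⟨ handshake circulant ⟨
    sum (map (degree circulant) (allFin ν)) ≤⟨ sum-map-≤ (degree circulant) (length J) degree≤ (allFin ν) ⟩
    length (allFin ν) * length J            ≡⟨ cong (_* length J) (length-tabulate {n = ν} id) ⟩
    ν * length J                            ∎
    where open ≤-Reasoning

-- Gaps between kept vertices: paths, or two arcs.

module GapScan {ν : ℕ} .{{_ : NonZero ν}} {J : List ℕ} (jumps : Jumps ν J)
               (k : ℕ) (short : ∀ {d} → d < k → suc d ∈ J)
               {K : Pred (Fin ν) 0ℓ} (K? : Decidable K) where

  open Cyclic ν
  open Circulant jumps

  kept : ℕ → ℕ → List (Fin ν)
  kept s l = filter K? (window s l)

  kept-++ : ∀ s a b → kept s (a + b) ≡ kept s a ++ kept (s + a) b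
  kept-++ s a b = trans (cong (filter K?) (window-++ s a b)) (filter-++ K? (window s a) (window (s + a) b))

  kept-all : ∀ s → kept s ν ↭ filter K? (allFin ν)
  kept-all s = filter-↭ K? (window-all s)

  length-kept≤ : ∀ s l → length (kept s l) ≤ l
  length-kept≤ s l = subst (length (kept s l) ≤_) (length-progression 1 s l) (length-filter K? (window s l))

  kept-full : ∀ s l → length (kept s l) ≡ l → kept s l ≡ window s l
  kept-full s l eq = filter-complete K? (trans eq (sym (length-progression 1 s l)))

  -- Inside the window, `i` positions precede the gap and `r` follow it.
  Gap : ℕ → ℕ → Set
  Gap s l = ∃[ i ] ∃[ r ] l ≡ i + (k + r) × kept (s + i) k ≡ []

  -- p is the last kept vertex seen so far; the e < k vertices after it are not kept.
  scan-from : ∀ p e l → K (vert p) → e < k → kept (suc p) e ≡ [] →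
              Linked (Adj circulant) (vert p ∷ kept (suc p + e) l) ⊎ Gap (suc p) (e + l)
  scan-from p e zero    Kp e<k none = inj₁ [-]
  scan-from p e (suc l) Kp e<k none with K? (vert (suc p + e))
  ... | yes Kx with scan-from (suc p + e) 0 l Kx (≤-<-trans z≤n e<k) refl
  -- The next kept vertex is `e + 1` positions after `p`, which is at most `k` and hence a jump.
  ...   | inj₁ linked = inj₁ (subst (Adj circulant (vert p) ∘ vert) (+-suc p e) (edge (short e<k) p)
                              ∷ subst (λ x → Linked (Adj circulant) (vert (suc p + e) ∷ kept x l))
                                      (+-identityʳ (suc (suc p + e))) linked)
  ...   | inj₂ (i , r , refl , none′) =
    inj₂ (e + suc i , r , +-assoc-suc e i (k + r) , subst (λ x → kept x k ≡ []) (shift-start p e i) none′)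
    where
    +-assoc-suc : ∀ e i x → e + suc (i + x) ≡ e + suc i + x
    +-assoc-suc = solve-∀
    shift-start : ∀ p e i → suc (suc p + e) + i ≡ suc p + (e + suc i)
    shift-start = solve-∀
  -- The run of missing vertices grows by one: either it is still shorter than `k` and the scan goes
  -- on from the same `p`, or it has become a gap.
  scan-from p e (suc l) Kp e<k none | no ¬Kx = continue (m≤n⇒m<n∨m≡n e<k)
    where
    none′ : kept (suc p) (suc e) ≡ []
    none′ = trans (cong (kept (suc p)) (+-comm 1 e))
      (trans (kept-++ (suc p) e 1) (cong₂ _++_ none (filter-reject K? ¬Kx)))

    continue : suc e < k ⊎ suc e ≡ k →
               Linked (Adj circulant) (vert p ∷ kept (suc (suc p + e)) l) ⊎ Gap (suc p) (e + suc l)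
    continue (inj₁ 1+e<k) = subst₂ (λ x y → Linked (Adj circulant) (vert p ∷ kept x l) ⊎ Gap (suc p) y)
      (+-suc (suc p) e) (sym (+-suc e l)) (scan-from p (suc e) l Kp 1+e<k none′)
    continue (inj₂ refl)  = inj₂ (0 , l , +-suc e l , subst (λ x → kept x (suc e) ≡ []) (sym (+-identityʳ (suc p))) none′)

  -- Missing vertices at the start of the window are skipped rather than counted towards a gap,
  -- since no kept vertex precedes them and no link has to cross them.
  scan : 0 < k → ∀ s l → Linked (Adj circulant) (kept s l) ⊎ Gap s l
  scan 0<k s zero    = inj₁ []
  scan 0<k s (suc l) = continue (K? (vert s))
    where
    shift-gap : Gap (suc s) l → Gap s (suc l)
    shift-gap (i , r , eq , none) = suc i , r , cong suc eq , subst (λ x → kept x k ≡ []) (sym (+-suc s i)) none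

    continue : Dec (K (vert s)) → Linked (Adj circulant) (kept s (suc l)) ⊎ Gap s (suc l)
    continue (yes Ks) with scan-from s 0 l Ks 0<k refl
    ... | inj₁ linked = inj₁ (subst (Linked (Adj circulant))
            (trans (cong (λ x → vert s ∷ kept x l) (+-identityʳ (suc s))) (sym (filter-accept K? Ks))) linked)
    ... | inj₂ gap    = inj₂ (shift-gap gap)
    continue (no ¬Ks) with scan 0<k (suc s) l
    ... | inj₁ linked = inj₁ (subst (Linked (Adj circulant)) (sym (filter-reject K? ¬Ks)) linked)
    ... | inj₂ gap    = inj₂ (shift-gap gap)

  -- The window that starts just after a gap loses its last k vertices.
  rotate : (gap : Gap 0 ν) → let (i , r , _) = gap in kept (i + k) (r + i) ↭ filter K? (allFin ν)
  rotate (i , r , ν≡ , none) = begin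
    kept (i + k) (r + i)                              ≡⟨ ++-identityʳ _ ⟨
    kept (i + k) (r + i) ++ []                        ≡⟨ cong (kept (i + k) (r + i) ++_) end-removed ⟨
    kept (i + k) (r + i) ++ kept (i + k + (r + i)) k  ≡⟨ kept-++ (i + k) (r + i) k ⟨
    kept (i + k) (r + i + k)                          ≡⟨ cong (kept (i + k)) (trans (rearrange₁ i k r) (sym ν≡)) ⟩
    kept (i + k) ν                                    ↭⟨ kept-all (i + k) ⟩
    filter K? (allFin ν)                              ∎
    where
    open Permutation.PermutationReasoning
    rearrange₁ : ∀ i k r → r + i + k ≡ i + (k + r)
    rearrange₁ = solve-∀
    rearrange₂ : ∀ i k r → i + k + (r + i) ≡ i + (i + (k + r))
    rearrange₂ = solve-∀
    -- The start `i + k + (r + i)` is `i + ν`: this is the same gap, one turn later.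
    end-removed : kept (i + k + (r + i)) k ≡ []
    end-removed = trans
      (cong (filter K?) (trans (cong (λ x → window x k) (trans (rearrange₂ i k r) (cong (i +_) (sym ν≡)))) (progression-+ν 1 i k)))
      none

  -- One gap separates the arc of length `a` at `s` from the arc of length `b`; the other closes the
  -- cycle after the second arc. The arcs may still contain positions that are not kept.
  TwoArcs : Set
  TwoArcs = ∃[ s ] ∃[ a ] ∃[ b ] a + b + (k + k) ≡ ν × kept s a ++ kept (s + a + k) b ↭ filter K? (allFin ν)

  -- The first scan cuts the cycle at 0, an arbitrary place. A gap found there is a better cut, so
  -- the second scan runs over the complement of that gap; whatever gap it meets is disjoint from
  -- the first.
  pairsUp⊎twoArcs : 0 < k → ∀ t → length (filter K? (allFin ν)) ≡ t * 2 →
                    PairsUp (Adj circulant) (filter K? (allFin ν)) ⊎ TwoArcs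
  pairsUp⊎twoArcs 0<k t even with scan 0<k 0 ν
  ... | inj₁ linked = inj₁ (resp-↭ (kept-all 0) (Linked⇒PairsUp t (trans (↭-length (kept-all 0)) even) linked))
  ... | inj₂ gap@(i , r , ν≡ , _) with scan 0<k (i + k) (r + i)
  ...   | inj₁ linked = inj₁ (resp-↭ (rotate gap) (Linked⇒PairsUp t (trans (↭-length (rotate gap)) even) linked))
  ...   | inj₂ (a , b , r+i≡ , none) = inj₂ (i + k , a , b , total , arcs)
    where
    rearrange₁ : ∀ i k r → i + (k + r) ≡ r + i + k
    rearrange₁ = solve-∀
    rearrange₂ : ∀ a b k → a + (k + b) + k ≡ a + b + (k + k)
    rearrange₂ = solve-∀
    total : a + b + (k + k) ≡ ν
    total = sym (trans ν≡ (trans (rearrange₁ i k r) (trans (cong (_+ k) r+i≡) (rearrange₂ a b k))))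

    open Permutation.PermutationReasoning
    arcs : kept (i + k) a ++ kept (i + k + a + k) b ↭ filter K? (allFin ν)
    arcs = begin
      kept (i + k) a ++ kept (i + k + a + k) b
        ≡⟨ cong (λ xs → kept (i + k) a ++ xs ++ kept (i + k + a + k) b) none ⟨
      kept (i + k) a ++ kept (i + k + a) k ++ kept (i + k + a + k) b
        ≡⟨ cong (kept (i + k) a ++_) (kept-++ (i + k + a) k b) ⟨
      kept (i + k) a ++ kept (i + k + a) (k + b) ≡⟨ kept-++ (i + k) a (k + b) ⟨
      kept (i + k) (a + (k + b))                 ≡⟨ cong (kept (i + k)) r+i≡ ⟨
      kept (i + k) (r + i)                       ↭⟨ rotate gap ⟩
      filter K? (allFin ν)                       ∎

  length-twoArcs≤ : ((s , a , b , _) : TwoArcs) → length (filter K? (allFin ν)) ≤ a + b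
  length-twoArcs≤ (s , a , b , _ , arcs) = begin
    length (filter K? (allFin ν))                     ≡⟨ ↭-length arcs ⟨
    length (kept s a ++ kept (s + a + k) b)           ≡⟨ length-++ (kept s a) ⟩
    length (kept s a) + length (kept (s + a + k) b)   ≤⟨ +-mono-≤ (length-kept≤ s a) (length-kept≤ (s + a + k) b) ⟩
    a + b                                             ∎
    where open ≤-Reasoning

  -- If as many vertices are kept as the arcs have positions, neither arc can have lost a vertex.
  twoArcs-full : ((s , a , b , _) : TwoArcs) → length (filter K? (allFin ν)) ≡ a + b →
                 window s a ++ window (s + a + k) b ↭ filter K? (allFin ν)
  twoArcs-full (s , a , b , _ , arcs) eq =
    subst (_↭ filter K? (allFin ν)) (cong₂ _++_ (kept-full s a a-full) (kept-full (s + a + k) b b-full)) arcs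
    where
    sum-full : length (kept s a) + length (kept (s + a + k) b) ≡ a + b
    sum-full = trans (sym (length-++ (kept s a))) (trans (↭-length arcs) eq)

    a-full : length (kept s a) ≡ a
    a-full = ≤-antisym (length-kept≤ s a) (+-cancelʳ-≤ b a _
      (subst (_≤ length (kept s a) + b) sum-full (+-monoʳ-≤ (length (kept s a)) (length-kept≤ (s + a + k) b))))

    b-full : length (kept (s + a + k) b) ≡ b
    b-full = +-cancelˡ-≡ a _ b (trans (cong (_+ length (kept (s + a + k) b)) (sym a-full)) sum-full)

-- Parity of the arcs and matching across the antipodal chord.

parity : ∀ h → ∃[ g ] (h ≡ g * 2 ⊎ h ≡ suc (g * 2))
parity zero    = 0 , inj₁ refl
parity (suc h) with parity h
... | g , inj₁ refl = g , inj₂ refl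
... | g , inj₂ refl = suc g , inj₁ refl

a*2≢1+b*2 : ∀ a b → a * 2 ≢ suc (b * 2)
a*2≢1+b*2 a b eq = even≢odd a b (trans (*-comm 2 a) (trans eq (cong suc (*-comm b 2))))

-- The jump 2 is needed only if the chord ends at an odd offset in the longer arc, and then m − k is
-- even; this is how k = 1 can do without it when m is even.
module AntipodalChord {ν : ℕ} .{{_ : NonZero ν}} {J : List ℕ} (jumps : Jumps ν J)
                      {m k : ℕ} (m+m≡ν : m + m ≡ ν) (m∈J : m ∈ J) (1∈J : 1 ∈ J)
                      (2∈J : ∀ c → m ≡ c * 2 + k → 2 ∈ J) where

  open Cyclic ν
  open Circulant jumps

  private
    Paired = PairsUp (Adj circulant)

  window-pairsUp : ∀ s t → Paired (window s (t * 2))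
  window-pairsUp = progression-pairsUp 1∈J

  -- This is a window with the vertex at offset `h` missing. Both sides of the hole have the parity
  -- of `h`. If it is even, each side is matched along the cycle; if it is odd, an edge of jump 2
  -- across the hole leaves an even run on either side.
  interrupted-window : ∀ i h y → (∀ g → h ≡ suc (g * 2) → 2 ∈ J) →
                       Paired (window y h ++ window (suc (y + h)) (i * 2 + h))
  interrupted-window i h y odd⇒2∈J with parity h
  ... | g , inj₁ refl =
    window-pairsUp y g ++ᵖ subst (Paired ∘ window (suc (y + g * 2))) (*-distribʳ-+ 2 i g) (window-pairsUp _ (i + g))
  ... | g , inj₂ refl = subst Paired
    (sym (cong₂ _++_ (trans (cong (window y) (+-comm 1 (g * 2))) (window-++ y (g * 2) 1))
                     (cong (window (suc (y + suc (g * 2)))) (rearrange₁ i g))))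
    (resp-↭ (↭-reflexive (sym (++-assoc (window y (g * 2)) _ _)))
      (window-pairsUp y g ++ᵖ pair bridge (window-pairsUp _ (i + g)) ↭-refl))
    where
    rearrange₁ : ∀ i g → i * 2 + suc (g * 2) ≡ suc ((i + g) * 2)
    rearrange₁ = solve-∀
    rearrange₂ : ∀ y x → y + x + 2 ≡ suc (y + suc x)
    rearrange₂ = solve-∀
    bridge : Adj circulant (vert (y + g * 2)) (vert (suc (y + suc (g * 2))))
    bridge = subst (Adj circulant (vert (y + g * 2)) ∘ vert) (rearrange₂ y (g * 2)) (edge (odd⇒2∈J g refl) (y + g * 2))

  -- The first vertex of the shorter arc is matched to its antipode, which lies in the longer arc.
  odd-arcs : ∀ s i h → suc (i * 2) + suc ((i + h) * 2) + (k + k) ≡ ν →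
             Paired (window s (suc (i * 2)) ++ window (s + suc (i * 2) + k) (suc ((i + h) * 2)))
  odd-arcs s i h total = pair chord
    (window-pairsUp (suc s) i ++ᵖ interrupted-window i h y λ { g refl → 2∈J (suc i + g) (trans m≡ (rearrange₃ i g k)) })
    (prep (vert s) (begin
      window (suc s) (i * 2) ++ window y (suc ((i + h) * 2))
        ≡⟨ cong (window (suc s) (i * 2) ++_) split ⟩
      window (suc s) (i * 2) ++ window y h ++ vert (y + h) ∷ window (suc (y + h)) (i * 2 + h)
        ↭⟨ ++⁺ˡ (window (suc s) (i * 2)) (shift _ (window y h) _) ⟩
      window (suc s) (i * 2) ++ vert (y + h) ∷ window y h ++ window (suc (y + h)) (i * 2 + h)
        ↭⟨ shift _ (window (suc s) (i * 2)) _ ⟩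
      vert (y + h) ∷ window (suc s) (i * 2) ++ window y h ++ window (suc (y + h)) (i * 2 + h) ∎))
    where
    open Permutation.PermutationReasoning
    y = s + suc (i * 2) + k

    rearrange₁ : ∀ i h k → (suc (i * 2 + h) + k) * 2 ≡ suc (i * 2) + suc ((i + h) * 2) + (k + k)
    rearrange₁ = solve-∀
    rearrange₂ : ∀ s i h k → s + (suc (i * 2 + h) + k) ≡ s + suc (i * 2) + k + h
    rearrange₂ = solve-∀
    rearrange₃ : ∀ i g k → suc (i * 2 + suc (g * 2)) + k ≡ (suc i + g) * 2 + k
    rearrange₃ = solve-∀
    rearrange₄ : ∀ i h → suc ((i + h) * 2) ≡ h + suc (i * 2 + h)
    rearrange₄ = solve-∀

    -- Half of `total`. Going `m` positions on from `s` passes the shorter arc and the `k` deleted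
    -- vertices and ends at offset `h` of the longer arc.
    m≡ : m ≡ suc (i * 2 + h) + k
    m≡ = *-cancelʳ-≡ m _ 2 (trans (m*2≡m+m m) (trans m+m≡ν (trans (sym total) (sym (rearrange₁ i h k)))))

    chord : Adj circulant (vert s) (vert (y + h))
    chord = subst (Adj circulant (vert s) ∘ vert) (trans (cong (s +_) m≡) (rearrange₂ s i h k)) (edge m∈J s)

    split : window y (suc ((i + h) * 2)) ≡ window y h ++ vert (y + h) ∷ window (suc (y + h)) (i * 2 + h)
    split = trans (cong (window y) (rearrange₄ i h)) (window-++ y h (suc (i * 2 + h)))

  arcs-pairsUp : ∀ s a b t → a + b ≡ t * 2 → a + b + (k + k) ≡ ν → Paired (window s a ++ window (s + a + k) b)
  arcs-pairsUp s a b t even total with parity a | parity b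
  ... | i , inj₁ refl | j , inj₁ refl = window-pairsUp s i ++ᵖ window-pairsUp _ j
  ... | i , inj₁ refl | j , inj₂ refl =
    contradiction (trans (sym even) (rearrange i j)) (a*2≢1+b*2 t (i + j))
    where
    rearrange : ∀ i j → i * 2 + suc (j * 2) ≡ suc ((i + j) * 2)
    rearrange = solve-∀
  ... | i , inj₂ refl | j , inj₁ refl =
    contradiction (trans (sym even) (rearrange i j)) (a*2≢1+b*2 t (i + j))
    where
    rearrange : ∀ i j → suc (i * 2) + j * 2 ≡ suc ((i + j) * 2)
    rearrange = solve-∀
  ... | i , inj₂ refl | j , inj₂ refl with ≤-total i j
  ...   | inj₁ i≤j with h , refl ← m≤n⇒∃[o]m+o≡n i≤j = odd-arcs s i h total
  -- The second arc is the shorter one, so the turn is started there; the first arc then follows it,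
  -- shifted by `ν`.
  ...   | inj₂ j≤i with h , refl ← m≤n⇒∃[o]m+o≡n j≤i =
    resp-↭ (↭-trans (++-comm (window y b) _) (↭-reflexive (cong (_++ window y b) wrap)))
           (odd-arcs y j h (trans (cong (_+ (k + k)) (+-comm b _)) total))
    where
    y = s + a + k
    rearrange : ∀ s a b k → s + a + k + b + k ≡ s + (a + b + (k + k))
    rearrange = solve-∀
    wrap : window (y + b + k) a ≡ window s a
    wrap = trans (cong (λ x → window x a) (trans (rearrange s a b k) (cong (s +_) total))) (progression-+ν 1 s a)

-- The circulant graph with jumps ±2 and m on 2m vertices, m odd, is the prism over the cycle of length m:
-- each of its two cycles is a row x, x + 2, x + 4, …, and the jump m exchanges the rows.
module Prism {ν : ℕ} .{{_ : NonZero ν}} {J : List ℕ} (jumps : Jumps ν J)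
             {c : ℕ} (m+m≡ν : suc (c * 2) + suc (c * 2) ≡ ν) (m∈J : suc (c * 2) ∈ J) (2∈J : 2 ∈ J) where

  open Cyclic ν
  open Circulant jumps

  private
    Paired = PairsUp (Adj circulant)

    m : ℕ
    m = suc (c * 2)

  row : ℕ → ℕ → List (Fin ν)
  row = progression 2

  window↭rows : ∀ s l → window s (l * 2) ↭ row s l ++ row (suc s) l
  window↭rows s zero    = ↭-refl
  window↭rows s (suc l) = prep _ (↭-trans (prep _ (window↭rows (2 + s) l)) (↭-sym (shift _ (row (2 + s) l) _)))

  -- Since `m` is odd, the row at `p + m` runs through the odd offsets from `p`, starting in the
  -- middle. After `suc c` terms it reaches `suc p + ν`; exchanging the two pieces there gives the
  -- row at `suc p`.
  rows-all : ∀ p → row p m ++ row (p + m) m ↭ allFin ν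
  rows-all p = begin
    row p m ++ row (p + m) m            ↭⟨ ++⁺ˡ (row p m) odd-offsets ⟩
    row p m ++ row (suc p) m            ↭⟨ window↭rows p m ⟨
    window p (m * 2)                    ≡⟨ cong (window p) (trans (m*2≡m+m m) m+m≡ν) ⟩
    window p ν                          ↭⟨ window-all p ⟩
    allFin ν                            ∎
    where
    open Permutation.PermutationReasoning
    split₁ : ∀ c → suc (c * 2) ≡ suc c + c
    split₁ = solve-∀
    split₂ : ∀ c → suc (c * 2) ≡ c + suc c
    split₂ = solve-∀
    wrap : ∀ p c → p + suc (c * 2) + suc c * 2 ≡ suc p + (suc (c * 2) + suc (c * 2))
    wrap = solve-∀
    half : ∀ p c → p + suc (c * 2) ≡ suc p + c * 2
    half = solve-∀
    odd-offsets : row (p + m) m ↭ row (suc p) m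
    odd-offsets = begin
      row (p + m) m                                        ≡⟨ cong (row (p + m)) (split₁ c) ⟩
      row (p + m) (suc c + c)                              ≡⟨ progression-++ 2 (p + m) (suc c) c ⟩
      row (p + m) (suc c) ++ row (p + m + suc c * 2) c
        ≡⟨ cong (λ x → row (p + m) (suc c) ++ row x c) (trans (wrap p c) (cong (suc p +_) m+m≡ν)) ⟩
      row (p + m) (suc c) ++ row (suc p + ν) c
        ≡⟨ cong₂ _++_ (cong (λ x → row x (suc c)) (half p c)) (progression-+ν 2 (suc p) c) ⟩
      row (suc p + c * 2) (suc c) ++ row (suc p) c         ↭⟨ ++-comm (row (suc p + c * 2) (suc c)) _ ⟩
      row (suc p) c ++ row (suc p + c * 2) (suc c)         ≡⟨ progression-++ 2 (suc p) c (suc c) ⟨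
      row (suc p) (c + suc c)                              ≡⟨ cong (row (suc p)) (split₂ c) ⟨
      row (suc p) m                                        ∎

  -- A perfect matching after the deletion of `u` and `w`, with the other vertices listed in
  -- whichever order suits the matching.
  AvoidingPairs : Fin ν → Fin ν → Set
  AvoidingPairs u w = ∃[ Z ] Paired Z × allFin ν ↭ u ∷ w ∷ Z

  swapped : ∀ {u w} → AvoidingPairs u w → AvoidingPairs w u
  swapped {u} {w} (Z , paired , σ) = Z , paired , ↭-trans σ (swap u w ↭-refl)

  -- Call the common index in the two rows a column. The deleted vertices have columns 0 and 2g + 1.
  -- The 2g vertices between them (`A`) and the 2g + 2 vertices facing columns 0 to 2g + 1 (`B`) are
  -- matched along their rows, and the last `f` columns by rungs.
  same-row : ∀ p g f → m ≡ suc (g * 2) + suc f → AvoidingPairs (vert p) (vert (p + suc (g * 2) * 2))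
  same-row p g f m≡ = (A ++ B) ++ (C ++ D)
    , (progression-pairsUp 2∈J (2 + p) g ++ᵖ progression-pairsUp 2∈J (p + m) (suc g)) ++ᵖ rungs-pairsUp m∈J 2 (2 + q) f
    , (begin
      allFin ν                                     ↭⟨ rows-all p ⟨
      row p m ++ row (p + m) m                     ≡⟨ cong₂ _++_ row₁ row₂ ⟩
      vert p ∷ (A ++ vert q ∷ C) ++ (B ++ D)       ↭⟨ prep _ (++⁺ʳ (B ++ D) (shift (vert q) A C)) ⟩
      vert p ∷ vert q ∷ (A ++ C) ++ (B ++ D)       ↭⟨ prep _ (prep _ (interchange A C B D)) ⟩
      vert p ∷ vert q ∷ (A ++ B) ++ (C ++ D)       ∎)
    where
    open Permutation.PermutationReasoning
    q = p + suc (g * 2) * 2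
    A = row (2 + p) (g * 2)
    B = row (p + m) (suc g * 2)
    C = row (2 + q) f
    D = row (2 + q + m) f
    start₁ : ∀ p x → 2 + p + x ≡ p + (2 + x)
    start₁ = solve-∀
    start₂ : ∀ p m g → p + m + suc g * 2 * 2 ≡ 2 + (p + suc (g * 2) * 2) + m
    start₂ = solve-∀
    row₁ : row p m ≡ vert p ∷ A ++ vert q ∷ C
    row₁ = trans (cong (row p) m≡) (cong (vert p ∷_) (trans (progression-++ 2 (2 + p) (g * 2) (suc f))
      (cong (λ x → A ++ row x (suc f)) (start₁ p (g * 2 * 2)))))
    row₂ : row (p + m) m ≡ B ++ D
    row₂ = trans (cong (row (p + m)) (trans m≡ (+-suc (suc (g * 2)) f))) (trans (progression-++ 2 (p + m) (suc g * 2) f)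
      (cong (λ x → B ++ row x f) (start₂ p m g)))

  -- The deleted vertices have columns 0 and 2g in different rows. In the columns 0 to 2g each row
  -- keeps 2g consecutive vertices, `A` and `B`, which are matched along the row; the other `f`
  -- columns are matched by rungs.
  opposite-rows : ∀ p g f → m ≡ g * 2 + suc f → AvoidingPairs (vert p) (vert (p + m + g * 2 * 2))
  opposite-rows p g f m≡ = (A ++ B) ++ (C ++ D)
    , (progression-pairsUp 2∈J (2 + p) g ++ᵖ progression-pairsUp 2∈J (p + m) g) ++ᵖ rungs-pairsUp m∈J 2 r f
    , (begin
      allFin ν                                     ↭⟨ rows-all p ⟨
      row p m ++ row (p + m) m                     ≡⟨ cong₂ _++_ row₁ row₂ ⟩
      vert p ∷ (A ++ C) ++ (B ++ vert q ∷ D)       ↭⟨ prep _ (++⁺ˡ (A ++ C) (shift (vert q) B D)) ⟩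
      vert p ∷ (A ++ C) ++ (vert q ∷ B ++ D)       ↭⟨ prep _ (shift (vert q) (A ++ C) (B ++ D)) ⟩
      vert p ∷ vert q ∷ (A ++ C) ++ (B ++ D)       ↭⟨ prep _ (prep _ (interchange A C B D)) ⟩
      vert p ∷ vert q ∷ (A ++ B) ++ (C ++ D)       ∎)
    where
    open Permutation.PermutationReasoning
    q = p + m + g * 2 * 2
    r = 2 + p + g * 2 * 2
    A = row (2 + p) (g * 2)
    B = row (p + m) (g * 2)
    C = row r f
    D = row (r + m) f
    start₁ : ∀ p m x → 2 + (p + m + x) ≡ 2 + p + x + m
    start₁ = solve-∀
    row₁ : row p m ≡ vert p ∷ A ++ C
    row₁ = trans (cong (row p) (trans m≡ (+-suc (g * 2) f))) (cong (vert p ∷_) (progression-++ 2 (2 + p) (g * 2) f))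
    row₂ : row (p + m) m ≡ B ++ vert q ∷ D
    row₂ = trans (cong (row (p + m)) m≡) (trans (progression-++ 2 (p + m) (g * 2) (suc f))
      (cong (λ x → B ++ vert q ∷ row x f) (start₁ p m (g * 2 * 2))))

  -- The rows are read from `u`, so `w` has some column `e`. If `e` has the wrong parity for the
  -- constructions above, the rows are read from `w` instead: `u` then has column `m − e`, of the
  -- other parity because `m` is odd.
  avoidingPairs : ∀ u w → u ≢ w → AvoidingPairs u w
  avoidingPairs u w u≢w = subst (λ v → AvoidingPairs v w) (vert-toℕ u)
    (locate (∈-++⁻ (row p m) (∈-resp-↭ (↭-sym (rows-all p)) (∈-allFin w))))
    where
    p = toℕ u
    twice : ∀ p e f → p + e * 2 + f * 2 ≡ p + ((e + f) + (e + f))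
    twice = solve-∀

    locate : w ∈ row p m ⊎ w ∈ row (p + m) m → AvoidingPairs (vert p) w
    locate (inj₁ w∈) with ∈-progression⁻ 2 p m w∈
    ... | e , f , m≡ , refl with parity e
    ...   | g     , inj₂ refl = same-row p g f m≡
    ...   | zero  , inj₁ refl = contradiction (sym (trans (cong vert (+-identityʳ p)) (vert-toℕ u))) u≢w
    ...   | suc g , inj₁ refl with parity f
    ...     | h , inj₂ refl = contradiction (trans (sym (rearrange g h)) (sym m≡)) (a*2≢1+b*2 (suc g + suc h) c)
      where
      rearrange : ∀ g h → suc g * 2 + suc (suc (h * 2)) ≡ (suc g + suc h) * 2
      rearrange = solve-∀
    ...     | h , inj₁ refl = swapped (subst (AvoidingPairs _) wrap (same-row (p + suc g * 2 * 2) h (suc (g * 2))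
                                (trans m≡ (+-comm (suc g * 2) (suc (h * 2))))))
      where
      wrap : vert (p + suc g * 2 * 2 + suc (h * 2) * 2) ≡ vert p
      wrap = trans (cong vert (trans (twice p (suc g * 2) (suc (h * 2)))
               (cong (p +_) (trans (cong₂ _+_ (sym m≡) (sym m≡)) m+m≡ν)))) (vert-+ν p)
    locate (inj₂ w∈) with ∈-progression⁻ 2 (p + m) m w∈
    ... | e , f , m≡ , refl with parity e
    ...   | g , inj₁ refl = opposite-rows p g f m≡
    ...   | g , inj₂ refl with parity f
    ...     | h , inj₁ refl = contradiction (trans (sym (rearrange g h)) (sym m≡)) (a*2≢1+b*2 (suc (g + h)) c)
      where
      rearrange : ∀ g h → suc (g * 2) + suc (h * 2) ≡ suc (g + h) * 2
      rearrange = solve-∀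
    ...     | h , inj₂ refl = swapped (subst (AvoidingPairs _) wrap (opposite-rows (p + m + suc (g * 2) * 2) (suc h) (g * 2)
                                (trans m≡ (+-comm (suc (g * 2)) (suc h * 2)))))
      where
      rearrange : ∀ p m x y → p + m + x + m + y ≡ p + x + y + (m + m)
      rearrange = solve-∀
      wrap : vert (p + m + suc (g * 2) * 2 + m + suc h * 2 * 2) ≡ vert p
      wrap = trans (cong vert (trans (rearrange p m (suc (g * 2) * 2) (suc h * 2 * 2))
               (cong₂ _+_ (trans (twice p (suc (g * 2)) (suc h * 2)) (cong (p +_) (trans (cong₂ _+_ (sym m≡) (sym m≡)) m+m≡ν))) m+m≡ν)))
               (trans (vert-+ν (p + ν)) (vert-+ν p))

  pairsUp-remaining : ∀ S → ∣ S ∣ ≡ 2 → Paired (remaining circulant S)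
  pairsUp-remaining S ∣S∣≡2 with u , w , u≢w , u∈S , w∈S ← two-elements S ∣S∣≡2
    with Z , paired , σ ← avoidingPairs u w u≢w =
    resp-↭ (↭-sym (↭-trans filtered (↭-reflexive (filter-complete K? full)))) paired
    where
    K? = Subset._∈? ∁ S
    filtered : remaining circulant S ↭ filter K? Z
    filtered = ↭-trans (filter-↭ K? σ) (↭-reflexive (trans
      -- Now both deleted vertices are gone. What is left to show is that `S` meets no vertex of
      -- `Z`, and this follows from the count `ν ∸ 2` on both sides.
      (filter-reject K? (Subset.x∈p⇒x∉∁p u∈S)) (filter-reject K? (Subset.x∈p⇒x∉∁p w∈S))))
    full : length (filter K? Z) ≡ length Z
    full = begin
      length (filter K? Z)               ≡⟨ ↭-length filtered ⟨
      length (remaining circulant S)     ≡⟨ length-elements (∁ S) ⟩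
      ∣ ∁ S ∣                            ≡⟨ Subset.∣∁p∣≡n∸∣p∣ S ⟩
      ν ∸ ∣ S ∣                          ≡⟨ cong (ν ∸_) ∣S∣≡2 ⟩
      ν ∸ 2                              ≡⟨ cong (_∸ 2) (trans (sym (length-tabulate {n = ν} id)) (↭-length σ)) ⟩
      length Z                           ∎
      where open ≡-Reasoning

  prism-connected : Connected circulant
  prism-connected = connected λ x → subst (Star (Adj circulant) (vert x))
    (trans (cong vert (trans (rearrange x c) (cong (suc x +_) m+m≡ν))) (vert-+ν (suc x)))
    -- One rung and `c + 1` steps along a row advance by m + 2(c + 1) = 2m + 1, which is 1 modulo
    -- `ν`.
    (edge m∈J x ◅ along-row (x + m) (suc c))
    where
    rearrange : ∀ x c → x + suc (c * 2) + suc c * 2 ≡ suc x + (suc (c * 2) + suc (c * 2))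
    rearrange = solve-∀
    along-row : ∀ x l → Star (Adj circulant) (vert x) (vert (x + l * 2))
    along-row x zero    = subst (Star (Adj circulant) (vert x)) (cong vert (sym (+-identityʳ x))) ε
    along-row x (suc l) = edge 2∈J x ◅ subst (λ y → Star (Adj circulant) (vert (x + 2)) (vert y))
                            (+-assoc x 2 (l * 2)) (along-row (x + 2) l)

-- Lists of jumps closed under negation modulo ν.

mirrored : ℕ → List ℕ → List ℕ
mirrored ν B = B ++ map (ν ∸_) B

mirrored-jumps : ∀ {ν B} → (∀ {d} → d ∈ B → 0 < d × d < ν) → Jumps ν (mirrored ν B)
mirrored-jumps {ν} {B} range = record
  { positive = λ d∈ → proj₁ (range′ (∈-++⁻ B d∈))
  ; bounded  = λ d∈ → proj₂ (range′ (∈-++⁻ B d∈))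
  ; mirror   = λ d∈ → mirror′ (∈-++⁻ B d∈)
  }
  where
  range′ : ∀ {d} → d ∈ B ⊎ d ∈ map (ν ∸_) B → 0 < d × d < ν
  range′ (inj₁ d∈) = range d∈
  range′ (inj₂ d∈) with e , e∈ , refl ← ∈-map⁻ (ν ∸_) d∈ with 0<e , e<ν ← range e∈ =
    m<n⇒0<n∸m e<ν , ∸-monoʳ-< 0<e (<⇒≤ e<ν)

  mirror′ : ∀ {d} → d ∈ B ⊎ d ∈ map (ν ∸_) B → ν ∸ d ∈ mirrored ν B
  mirror′ (inj₁ d∈) = ∈-++⁺ʳ B (∈-map⁺ (ν ∸_) d∈)
  mirror′ (inj₂ d∈) with e , e∈ , refl ← ∈-map⁻ (ν ∸_) d∈ =
    ∈-++⁺ˡ (subst (_∈ B) (sym (m∸[m∸n]≡n (<⇒≤ (proj₂ (range e∈))))) e∈)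

length-mirrored : ∀ ν B → length (mirrored ν B) ≡ length B + length B
length-mirrored ν B = trans (length-++ B) (cong (length B +_) (length-map (ν ∸_) B))

-- The jump `m` is its own mirror and so enters only once; this yields the odd number n + 1 of jumps
-- that an even n calls for.
antipodal-jumps : ∀ {ν J m} → 0 < m → m + m ≡ ν → Jumps ν J → Jumps ν (m ∷ J)
antipodal-jumps {ν} {J} {m} 0<m m+m≡ν jumps = record
  { positive = λ { (here refl) → 0<m ; (there d∈) → positive d∈ }
  ; bounded  = λ { (here refl) → subst (m <_) m+m≡ν (m<m+n m 0<m) ; (there d∈) → bounded d∈ }
  ; mirror   = λ { (here refl) → here (trans (cong (_∸ m) (sym m+m≡ν)) (m+n∸n≡m m m)) ; (there d∈) → there (mirror d∈) }
  }
  where open Jumps jumps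

up-to : ℕ → List ℕ
up-to = applyUpTo suc

∈-up-to : ∀ {k i} → i < k → suc i ∈ up-to k
∈-up-to = ∈-applyUpTo⁺ suc

up-to-range : ∀ {k ν} → k < ν → ∀ {d} → d ∈ up-to k → 0 < d × d < ν
up-to-range k<ν d∈ with i , i<k , refl ← ∈-applyUpTo⁻ suc d∈ = s≤s z≤n , ≤-<-trans i<k k<ν

-- Here `suc j` is the number of pairs in a perfect matching of what remains; that it is positive
-- gives `n + 2 ≤ ν`.
≡-mod-2⇒∃ : ∀ {n ν} → n < ν → n % 2 ≡ ν % 2 → ∃[ j ] ν ≡ n + suc j * 2
≡-mod-2⇒∃ {n} n<ν eq with x , refl ← m≤n⇒∃[o]m+o≡n n<ν with parity x
... | j , inj₂ refl = j , sym (+-suc n (suc (j * 2)))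
... | g , inj₁ refl = contradiction (trans eq ([m+kn]%n≡m%n (suc n) g 2)) (n%2≢1+n%2 n)
  where
  n%2≢1+n%2 : ∀ n → n % 2 ≢ suc n % 2
  n%2≢1+n%2 (suc (suc n)) eq = n%2≢1+n%2 n eq

∣∁S∣ : ∀ {n x} (S : Subset (n + x)) → ∣ S ∣ ≡ n → ∣ ∁ S ∣ ≡ x
∣∁S∣ {n} {x} S ∣S∣≡n = trans (Subset.∣∁p∣≡n∸∣p∣ S) (trans (cong (n + x ∸_) ∣S∣≡n) (m+n∸m≡n n x))

-- From a graph with few edges to the minimum.

module _ {ν : ℕ} (n : ℕ) where

  Realises : ℕ → Set₁
  Realises m = Σ[ G ∈ Graph (Fin ν) ] (Connected G × FactorCritical n G × numEdges G ≡ m)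

  -- Together with the lower bound for `G` itself, `upper` becomes an equality, so the division by 2
  -- is exact; for any other graph the lower bound is halved by monotonicity.
  isMinimum : ∀ (G : Graph (Fin ν)) → Connected G → FactorCritical n G → numEdges G * 2 ≤ ν * (n + 1) →
              IsMinimum Realises (ν * (n + 1) / 2)
  isMinimum G conn fc upper =
    (G , conn , fc , trans (sym (m*n/n≡m (numEdges G) 2)) (cong (_/ 2) (≤-antisym upper (numEdges-lower fc)))) ,
    λ { _ (H , _ , fc′ , refl) → subst (ν * (n + 1) / 2 ≤_) (m*n/n≡m (numEdges H) 2) (/-monoˡ-≤ 2 (numEdges-lower fc′)) }

  module _ .{{_ : NonZero ν}} {J : List ℕ} (jumps : Jumps ν J) where

    open Circulant jumps

    circulant-isMinimum : n + 2 ≤ ν → length J ≡ n + 1 → Connected circulant →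
                          (∀ S → ∣ S ∣ ≡ n → PairsUp (Adj circulant) (remaining circulant S)) →
                          IsMinimum Realises (ν * (n + 1) / 2)
    circulant-isMinimum n+2≤ν ∣J∣ conn pairs = isMinimum circulant conn
      (record { bound = n+2≤ν ; critical = λ S ∣S∣≡n → pairsUp⇒perfectMatching circulant S (pairs S ∣S∣≡n) })
      (subst (λ x → numEdges circulant * 2 ≤ ν * x) ∣J∣ numEdges-upper)

    consecutive : 1 ∈ J → ∀ x → Star (Adj circulant) (Cyclic.vert ν x) (Cyclic.vert ν (suc x))
    consecutive 1∈J x = subst (Adj circulant (Cyclic.vert ν x) ∘ Cyclic.vert ν) (+-comm x 1) (edge 1∈J x) ◅ ε

n+2≤n+2[1+j] : ∀ n j → n + 2 ≤ n + suc j * 2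
n+2≤n+2[1+j] n j = +-monoʳ-≤ n (m≤m+n 2 (j * 2))

-- Odd n: powers of a cycle.

module OddCase (c j : ℕ) where

  n k ν : ℕ
  n = suc (c * 2)
  k = suc c
  ν = n + suc j * 2

  k<ν : k < ν
  k<ν = s≤s (begin-strict
    c                  ≤⟨ m≤m*n c 2 ⟩
    c * 2              <⟨ m<m+n (c * 2) (s≤s z≤n) ⟩
    c * 2 + suc j * 2  ∎)
    where open ≤-Reasoning

  jumps : Jumps ν (mirrored ν (up-to k))
  jumps = mirrored-jumps (up-to-range k<ν)

  short : ∀ {d} → d < k → suc d ∈ mirrored ν (up-to k)
  short d<k = ∈-++⁺ˡ (∈-up-to d<k)

  length-jumps : length (mirrored ν (up-to k)) ≡ n + 1
  length-jumps = trans (length-mirrored ν (up-to k)) (trans (cong (λ x → x + x) (length-applyUpTo suc k)) (rearrange c))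
    where
    rearrange : ∀ c → suc c + suc c ≡ suc (c * 2) + 1
    rearrange = solve-∀

  open Circulant jumps

  pairs : ∀ S → ∣ S ∣ ≡ n → PairsUp (Adj circulant) (remaining circulant S)
  pairs S ∣S∣≡n = resolve (pairsUp⊎twoArcs (s≤s z≤n) (suc j) length-kept)
    where
    open GapScan jumps k short (Subset._∈? ∁ S)

    length-kept : length (remaining circulant S) ≡ suc j * 2
    length-kept = trans (length-elements (∁ S)) (∣∁S∣ {n} S ∣S∣≡n)

    rearrange : ∀ c x → suc (suc (c * 2) + x) ≡ x + (suc c + suc c)
    rearrange = solve-∀

    resolve : PairsUp (Adj circulant) (remaining circulant S) ⊎ TwoArcs →
              PairsUp (Adj circulant) (remaining circulant S)
    resolve (inj₁ paired) = paired
    -- The two gaps alone account for 2k = n + 1 missing vertices, one more than were deleted.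
    resolve (inj₂ arcs@(s , a , b , total , _)) = contradiction total (>⇒≢ (begin
      suc ν                  ≡⟨ rearrange c (suc j * 2) ⟩
      suc j * 2 + (k + k)    ≤⟨ +-monoˡ-≤ (k + k) (subst (_≤ a + b) length-kept (length-twoArcs≤ arcs)) ⟩
      a + b + (k + k)        ∎))
      where open ≤-Reasoning

  theorem : IsMinimum (Realises n) (ν * (n + 1) / 2)
  theorem = circulant-isMinimum n jumps (n+2≤n+2[1+j] n j) length-jumps
    (connected (consecutive n jumps (short (s≤s z≤n)))) pairs

-- Even n: powers of a cycle with antipodal chords, and the prism.

module EvenCase (k-1 j : ℕ) where

  k n m ν : ℕ
  k = suc k-1
  n = k * 2
  m = k + suc j
  ν = n + suc j * 2

  m+m≡ν : m + m ≡ ν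
  m+m≡ν = rearrange k-1 j
    where
    rearrange : ∀ k j → (suc k + suc j) + (suc k + suc j) ≡ suc k * 2 + suc j * 2
    rearrange = solve-∀

  k<ν : k < ν
  k<ν = s≤s (s≤s (begin
    k-1                    ≤⟨ m≤m*n k-1 2 ⟩
    k-1 * 2                ≤⟨ m≤m+n (k-1 * 2) (suc j * 2) ⟩
    k-1 * 2 + suc j * 2    ∎))
    where open ≤-Reasoning

  jumps : Jumps ν (m ∷ mirrored ν (up-to k))
  jumps = antipodal-jumps (s≤s z≤n) m+m≡ν (mirrored-jumps (up-to-range k<ν))

  short : ∀ {d} → d < k → suc d ∈ m ∷ mirrored ν (up-to k)
  short d<k = there (∈-++⁺ˡ (∈-up-to d<k))

  length-jumps : length (m ∷ mirrored ν (up-to k)) ≡ n + 1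
  length-jumps = trans (cong suc (trans (length-mirrored ν (up-to k))
    (cong (λ x → x + x) (length-applyUpTo suc k)))) (rearrange k-1)
    where
    rearrange : ∀ k → suc (suc k + suc k) ≡ suc k * 2 + 1
    rearrange = solve-∀

  module _ (2∈J : ∀ c → m ≡ c * 2 + k → 2 ∈ m ∷ mirrored ν (up-to k)) where

    open Circulant jumps
    open AntipodalChord jumps m+m≡ν (here refl) (short (s≤s z≤n)) 2∈J

    pairs : ∀ S → ∣ S ∣ ≡ n → PairsUp (Adj circulant) (remaining circulant S)
    pairs S ∣S∣≡n = resolve (pairsUp⊎twoArcs (s≤s z≤n) (suc j) length-kept)
      where
      open GapScan jumps k short (Subset._∈? ∁ S)

      length-kept : length (remaining circulant S) ≡ suc j * 2
      length-kept = trans (length-elements (∁ S)) (∣∁S∣ {n} S ∣S∣≡n)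

      rearrange : ∀ k x → k * 2 + x ≡ x + (k + k)
      rearrange = solve-∀

      resolve : PairsUp (Adj circulant) (remaining circulant S) ⊎ TwoArcs →
                PairsUp (Adj circulant) (remaining circulant S)
      resolve (inj₁ paired) = paired
      resolve (inj₂ arcs@(s , a , b , total , _)) =
        resp-↭ (twoArcs-full arcs (trans length-kept (sym a+b≡))) (arcs-pairsUp s a b (suc j) a+b≡ total)
        where
        a+b≡ : a + b ≡ suc j * 2
        a+b≡ = +-cancelʳ-≡ (k + k) (a + b) _ (trans total (rearrange k (suc j * 2)))

    antipodal-theorem : IsMinimum (Realises n) (ν * (n + 1) / 2)
    antipodal-theorem = circulant-isMinimum n jumps (n+2≤n+2[1+j] n j) length-jumps
      (connected (consecutive n jumps (short (s≤s z≤n)))) pairs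

module PrismCase (j c : ℕ) (m≡ : 2 + j ≡ 1 + c * 2) where

  ν m : ℕ
  ν = 2 + suc j * 2
  m = suc (c * 2)

  m+m≡ν : m + m ≡ ν
  m+m≡ν = trans (sym (m*2≡m+m m)) (cong (_* 2) (sym m≡))

  jumps : Jumps ν (m ∷ mirrored ν (2 ∷ []))
  jumps = antipodal-jumps (s≤s z≤n) m+m≡ν
    (mirrored-jumps {B = 2 ∷ []} λ { (here refl) → s≤s z≤n , s≤s (s≤s (s≤s z≤n)) })

  open Prism jumps {c} m+m≡ν (here refl) (there (here refl))

  prism-theorem : IsMinimum (Realises 2) (ν * (2 + 1) / 2)
  prism-theorem = circulant-isMinimum 2 jumps (n+2≤n+2[1+j] 2 j) refl prism-connected pairsUp-remaining

-- For n = 2 and ν/2 odd the antipodal chords of a cycle would leave the graph bipartite.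
even-theorem : ∀ k-1 j → let n = suc k-1 * 2 ; ν = n + suc j * 2 in IsMinimum (Realises {ν} n) (ν * (n + 1) / 2)
-- Here `k` is at least 2, so 2 is one of the short jumps.
even-theorem (suc k) j = EvenCase.antipodal-theorem (suc k) j λ _ _ → EvenCase.short (suc k) j (s≤s (s≤s z≤n))
even-theorem zero    j with parity (suc (suc j))
... | c , inj₂ m≡ = PrismCase.prism-theorem j c m≡
-- With `k = 1` and `m` even, `m − k` is odd, so the situation that would call for the jump 2 never
-- arises.
... | c , inj₁ m≡ = EvenCase.antipodal-theorem zero j λ d m≡′ →
  contradiction (trans (sym m≡) (trans m≡′ (+-comm (d * 2) 1))) (a*2≢1+b*2 c d)

mainTheorem1 : ∀ (n ν : ℕ) → 1 ≤ n → n < ν → n % 2 ≡ ν % 2 →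
    IsMinimum
    (λ m → Σ[ G ∈ Graph (Fin ν) ] (Connected G × FactorCritical n G × numEdges G ≡ m))
    (ν * (n + 1) / 2)
mainTheorem1 n ν 1≤n n<ν eq with j , refl ← ≡-mod-2⇒∃ n<ν eq with parity n
... | c     , inj₂ refl = OddCase.theorem c j
-- Half of an even `n` is positive because `1 ≤ n`.
... | suc k , inj₁ refl = even-theorem k j
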